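{- For all integers $n \ge 4$, $\mathrm{ar}^{\star}(n, K_4) = 2n-3$.
   Context: A star-colouring of a graph $G$ is an edge-colouring of $G$ in which every colour class is a star (a copy of $K_{1,m}$ with $m\ge 1$, a single edge being allowed). An edge-coloured graph is rainbow if all its edges have different colours. For a graph $H$, $\mathrm{ar}^{\star}(n,H)$ denotes the maximum $s\in\mathbb N$ such that there exists a star-colouring of $K_n$ using exactly $s$ colours and without a rainbow copy of $H$. -}

module Defs where

open import Data.Fin.Base using (Fin; zero)
open import Data.Nat.Base using (ℕ; suc; _≤_)
open import Data.Product.Base using (Σ; ∃; ∃-syntax; _×_; _,_; swap)
open import Data.Sum.Base using (_⊎_; inj₁; inj₂)
import Data.Sum.Base as Sum
open import Function.Bundles using (_⇔_)
open import Function.Definitions using (Injective)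
open import Relation.Binary.Definitions using (Symmetric; Irreflexive)
open import Relation.Binary.PropositionalEquality using (_≡_; _≢_; refl; ≢-sym)
open import Relation.Nullary.Negation.Core using (¬_)

record Graph (n : ℕ) : Set₁ where
  field
    Adj    : Fin n → Fin n → Set
    sym    : Symmetric Adj
    irrefl : Irreflexive _≡_ Adj

open Graph public using (Adj)

K : (n : ℕ) → Graph n
K n = record
  { Adj    = _≢_
  ; sym    = ≢-sym
  ; irrefl = λ u≡v u≢v → u≢v u≡v
  }

-- The star K_{1,m}, with centre zero and leaves suc i.
Star : (m : ℕ) → Graph (suc m)
Star m = record
  { Adj    = λ i j → (i ≡ zero × j ≢ zero) ⊎ (i ≢ zero × j ≡ zero)
  ; sym    = λ e → Sum.swap (Sum.map swap swap e)
  ; irrefl = λ { refl (inj₁ (p , q)) → q p ; refl (inj₂ (p , q)) → p q }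
  }

-- Irrelevance of the adjacency proof and symmetry make the colour a function
-- of the unordered pair {u , v} alone; non-edges receive no colour.
record Colouring {n : ℕ} (G : Graph n) (s : ℕ) : Set where
  field
    colour     : (u v : Fin n) → .(Adj G u v) → Fin s
    colour-sym : ∀ u v (e : Adj G u v) →
                 colour u v e ≡ colour v u (Graph.sym G e)

open Colouring public using (colour)

module _ {n : ℕ} {G : Graph n} {s : ℕ} (c : Colouring G s) where

  InClass : Fin s → Fin n → Fin n → Set
  InClass k u v = Σ (Adj G u v) λ e → colour c u v e ≡ k

  UsesAllColours : Set
  UsesAllColours = ∀ k → ∃[ u ] ∃[ v ] InClass k u v

  -- The edges coloured k are exactly the edges of some copy of H; vertices
  -- not incident with such an edge are not part of the colour class.
  ClassIsCopyOf : ∀ {h} → Graph h → Fin s → Set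
  ClassIsCopyOf {h} H k =
    Σ (Fin h → Fin n) λ f →
      Injective _≡_ _≡_ f ×
      (∀ u v → InClass k u v ⇔ (∃[ i ] ∃[ j ] (Adj H i j × f i ≡ u × f j ≡ v)))

  -- Only colours that occur have a colour class.
  IsStarColouring : Set
  IsStarColouring = ∀ k → (∃[ u ] ∃[ v ] InClass k u v) →
    ∃[ m ] (1 ≤ m × ClassIsCopyOf (Star m) k)

SameEdge : ∀ {h} → (i j i′ j′ : Fin h) → Set
SameEdge i j i′ j′ = (i ≡ i′ × j ≡ j′) ⊎ (i ≡ j′ × j ≡ i′)

-- Copies are subgraphs, not necessarily induced.
record RainbowCopy {n h s : ℕ} {G : Graph n} (c : Colouring G s) (H : Graph h) : Set where
  field
    vertex    : Fin h → Fin n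
    injective : Injective _≡_ _≡_ vertex
    edge      : ∀ {i j} → Adj H i j → Adj G (vertex i) (vertex j)
    rainbow   : ∀ {i j i′ j′} (e : Adj H i j) (e′ : Adj H i′ j′) →
                ¬ SameEdge i j i′ j′ →
                colour c (vertex i) (vertex j) (edge e) ≢
                colour c (vertex i′) (vertex j′) (edge e′)

StarColourableWithout : ∀ {h} → ℕ → Graph h → ℕ → Set
StarColourableWithout n H s =
  Σ (Colouring (K n) s) λ c →
    IsStarColouring c × UsesAllColours c × ¬ RainbowCopy c H

IsMaximum : (ℕ → Set) → ℕ → Set
IsMaximum P s = P s × (∀ t → P t → t ≤ s)

-- ar⋆[ n , H ]≐ s says that the maximum ar⋆(n, H) exists and equals s.
ar⋆[_,_]≐_ : ∀ {h} → ℕ → Graph h → ℕ → Set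
ar⋆[ n , H ]≐ s = IsMaximum (StarColourableWithout n H) s

{-# OPTIONS --safe #-}
-- Upper bound: let f(S) be the number of colours seen inside a vertex set S.
-- We show f(S) ≤ 2|S| − 3 by induction on |S| = m, averaging f(S − v) over v.
-- A colour seen in S is still seen in S − v for all but two vertices v, and for
-- all but one if its class in S is a star with at least two edges. Without a
-- rainbow K₄ at least m − 3 vertices are centres of such stars, as two edges of
-- equal colour meet in a centre, so that any four non-centres span a rainbow K₄.
-- Hence (m − 2) f(S) + (m − 3) ≤ Σ f(S − v) ≤ m (2m − 5), so f(S) < 2m − 2.
--
-- Lower bound: each new vertex brings two new colours, one for a single edge
-- and one for all its other edges. Among three edges at that vertex two then
-- have the same colour.
module Submission where

open import Data.Empty using (⊥; ⊥-elim-irr)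
open import Data.Fin.Base using (Fin; zero; suc; punchIn; punchOut; _↑ˡ_; _↑ʳ_)
open import Data.Fin.Patterns using (0F; 1F)
open import Data.Fin.Properties
  using (_≟_; any?; 0≢1+n; suc-injective; punchIn-injective; punchInᵢ≢i; punchIn-punchOut;
         pigeonhole; injective⇒≤; <⇒≢; ↑ʳ-injective)
open import Data.Nat.Base using (ℕ; zero; suc; _+_; _≤_; _<_; _*_; _∸_; z≤n; s≤s; z<s; s<s)
open import Data.Nat.Properties
  using (+-*-semiring; +-identityʳ; +-assoc; +-mono-≤; +-monoʳ-≤; +-monoˡ-≤;
         +-cancelʳ-≤; +-cancelˡ-≤; +-cancelʳ-<; *-zeroʳ; *-identityʳ; *-comm; *-cancelˡ-<;
         ≤-refl; ≤-trans; ≤-reflexive; ≤-pred; ≮⇒≥; m≤m+n; m≤n+m; module ≤-Reasoning)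
open import Data.Nat.Tactic.RingSolver using (solve-∀)
open import Data.Product.Base using (Σ; ∃; ∃-syntax; _×_; _,_; proj₁; proj₂)
open import Data.Sum.Base using (_⊎_; inj₁; inj₂)
open import Function.Base using (_∘_; id)
open import Function.Bundles using (mk⇔; Equivalence)
open import Function.Definitions using (Injective)
open import Level using (0ℓ)
open import Relation.Binary.PropositionalEquality
  using (_≡_; _≢_; refl; sym; trans; cong; cong₂; subst; subst₂; ≢-sym)
open import Relation.Nullary.Decidable.Core using (Dec; yes; no; ¬?; _×-dec_)
open import Relation.Nullary.Negation.Core using (¬_; contradiction)
open import Relation.Unary using (Pred; Decidable)
open import Defs

open import Algebra.Properties.Semiring.Sum +-*-semiring
  using (sum; sum-syntax; ∑-distrib-+; ∑-comm; *-distribˡ-sum)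

-- Counting

𝟙 : ∀ {A : Set} → Dec A → ℕ
𝟙 (yes _) = 1
𝟙 (no _)  = 0

count : ∀ {n} {P : Pred (Fin n) 0ℓ} → Decidable P → ℕ
count P? = sum (λ i → 𝟙 (P? i))

sum-mono-≤ : ∀ {n} {f g : Fin n → ℕ} → (∀ i → f i ≤ g i) → sum f ≤ sum g
sum-mono-≤ {zero}  f≤g = z≤n
sum-mono-≤ {suc n} f≤g = +-mono-≤ (f≤g zero) (sum-mono-≤ (f≤g ∘ suc))

sum-const : ∀ n a → ∑[ i < n ] a ≡ n * a
sum-const zero    a = refl
sum-const (suc n) a = cong (a +_) (sum-const n a)

1≤𝟙 : ∀ {A : Set} (a? : Dec A) → A → 1 ≤ 𝟙 a?
1≤𝟙 (yes _) _ = ≤-refl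
1≤𝟙 (no ¬a) a = contradiction a ¬a

sum-≥1 : ∀ {n} {f : Fin n → ℕ} → (∀ i → 1 ≤ f i) → n ≤ sum f
sum-≥1 {zero}  1≤f = z≤n
sum-≥1 {suc n} 1≤f = +-mono-≤ (1≤f zero) (sum-≥1 (1≤f ∘ suc))

count-none : ∀ {n} {P : Pred (Fin n) 0ℓ} (P? : Decidable P) →
             (∀ i → ¬ P i) → count P? ≡ 0
count-none {zero}  P? ¬p = refl
count-none {suc n} P? ¬p with P? zero
... | yes p = contradiction p (¬p zero)
... | no _  = count-none (P? ∘ suc) (¬p ∘ suc)

count-some : ∀ {n} {P : Pred (Fin n) 0ℓ} (P? : Decidable P) → ∃ P → 1 ≤ count P?
count-some P? (zero  , p) = ≤-trans (1≤𝟙 (P? zero) p) (m≤m+n _ _)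
count-some P? (suc i , p) = ≤-trans (count-some (P? ∘ suc) (i , p)) (m≤n+m _ _)

count-unique : ∀ {n} {P : Pred (Fin n) 0ℓ} (P? : Decidable P) →
               (∀ i j → P i → P j → i ≡ j) → count P? ≤ 1
count-unique {zero}  P? uniq = z≤n
count-unique {suc n} P? uniq with P? zero
... | yes p = s≤s (≤-reflexive (count-none (P? ∘ suc) λ i q → contradiction (uniq zero (suc i) p q) 0≢1+n))
... | no _  = count-unique (P? ∘ suc) λ i j p q → suc-injective (uniq (suc i) (suc j) p q)

choose : ∀ {n} {P : Pred (Fin n) 0ℓ} (P? : Decidable P) h → h ≤ count P? →
         Σ (Fin h → Fin n) λ f → Injective _≡_ _≡_ f × (∀ i → P (f i))
choose P? zero    _ = (λ ()) , (λ { {()} }) , λ ()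
choose {suc n} P? (suc h) h≤ with P? zero
... | no _  = let f , f-inj , Pf = choose (P? ∘ suc) (suc h) h≤
              in suc ∘ f , f-inj ∘ suc-injective , Pf
... | yes p = let f , f-inj , Pf = choose (P? ∘ suc) h (≤-pred h≤)
              in (λ { zero → zero ; (suc i) → suc (f i) })
               , (λ { {zero}  {zero}  _  → refl
                    ; {suc i} {suc j} eq → cong suc (f-inj (suc-injective eq)) })
               , λ { zero → p ; (suc i) → Pf i }

-- The upper bound

-- The centre is the image of `zero`, which lies on every edge of the star. For a single edge this
-- fixes one of its two ends. The upper bound uses the star condition only in this form.
star-centre : ∀ {n s} {G : Graph n} (c : Colouring G s) → IsStarColouring c → ∀ k →
              (∃[ u ] ∃[ v ] InClass c k u v) →
              ∃[ z ] (∀ {u v} → InClass c k u v → u ≡ z ⊎ v ≡ z)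
star-centre c star k used with star k used
... | m , _ , f , _ , copy = f zero , λ {u} {v} e → at-centre (Equivalence.to (copy u v) e)
  where
  at-centre : ∀ {u v} → (∃[ i ] ∃[ j ] (Adj (Star m) i j × f i ≡ u × f j ≡ v)) →
              u ≡ f zero ⊎ v ≡ f zero
  at-centre (_ , _ , inj₁ (refl , _) , refl , refl) = inj₁ refl
  at-centre (_ , _ , inj₂ (_ , refl) , refl , refl) = inj₂ refl

-- Colour classes inside a vertex set

module _ {n s} (c : Colouring (K n) s) where

  InClass? : ∀ k u v → Dec (InClass c k u v)
  InClass? k u v with u ≟ v
  ... | yes u≡v = no λ (u≢v , _) → u≢v u≡v
  ... | no u≢v with colour c u v u≢v ≟ k
  ...   | yes eq = yes (u≢v , eq)
  -- `colour` ignores which proof of `u ≢ v` it receives, so `neq` refutes `eq` for any adjacency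
  -- proof.
  ...   | no neq = no λ (_ , eq) → neq eq

  InClass-sym : ∀ {k u v} → InClass c k u v → InClass c k v u
  InClass-sym {u = u} {v} (u≢v , eq) = ≢-sym u≢v , trans (sym (Colouring.colour-sym c u v u≢v)) eq

  -- Vertex sets of size m are given by injections g : Fin m → Fin n.
  module _ {m} (g : Fin m → Fin n) where

    Seen : Fin s → Set
    Seen k = ∃[ i ] ∃[ j ] InClass c k (g i) (g j)

    -- Opaque, since otherwise sums over Fin (suc m) unfold into these decision procedures.
    opaque
      Seen? : Decidable Seen
      Seen? k = any? λ i → any? λ j → InClass? k (g i) (g j)

    -- Witnesses that the class of `k` has at least two edges inside the set and that `i` is their
    -- common end. A class with a single edge inside the set has no cherry.
    Cherry : Fin s → Fin m → Set
    Cherry k i = ∃[ j ] ∃[ j′ ] (j ≢ j′ × InClass c k (g i) (g j) × InClass c k (g i) (g j′))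

    opaque
      Cherry? : ∀ k → Decidable (Cherry k)
      Cherry? k i = any? λ j → any? λ j′ →
        ¬? (j ≟ j′) ×-dec InClass? k (g i) (g j) ×-dec InClass? k (g i) (g j′)

    IsCentre : Fin m → Set
    IsCentre i = ∃[ k ] Cherry k i

    IsCentre? : Decidable IsCentre
    IsCentre? i = any? λ k → Cherry? k i

  Seen-delete : ∀ {m} (g : Fin (suc m) → Fin n) {k v i j} → v ≢ i → v ≢ j →
                InClass c k (g i) (g j) → Seen (g ∘ punchIn v) k
  Seen-delete g v≢i v≢j e = punchOut v≢i , punchOut v≢j ,
    subst₂ (InClass c _) (cong g (sym (punchIn-punchOut v≢i))) (cong g (sym (punchIn-punchOut v≢j))) e

  -- The two edges at `i` have different other ends, so deleting `v` destroys at most one of them.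
  Seen-delete-cherry : ∀ {m} (g : Fin (suc m) → Fin n) {k v i} → v ≢ i →
                       Cherry g k i → Seen (g ∘ punchIn v) k
  Seen-delete-cherry g {v = v} v≢i (j , j′ , j≢j′ , e , e′) with v ≟ j
  ... | yes refl = Seen-delete g v≢i j≢j′ e′
  ... | no v≢j   = Seen-delete g v≢i v≢j e

  module _ (centre : Fin s → Fin n)
           (at-centre : ∀ {k u v} → InClass c k u v → u ≡ centre k ⊎ v ≡ centre k) where

    -- Otherwise the centre would be the far end of both edges, but these far ends differ.
    cherry-at-centre : ∀ {m} {g : Fin m → Fin n} → Injective _≡_ _≡_ g →
                       ∀ {k i} → Cherry g k i → g i ≡ centre k
    cherry-at-centre g-inj (_ , _ , j≢j′ , e , e′) with at-centre e | at-centre e′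
    ... | inj₁ p | _      = p
    ... | inj₂ _ | inj₁ q = q
    ... | inj₂ p | inj₂ q = contradiction (g-inj (trans p (sym q))) j≢j′

    -- The contribution of one colour to the averaging. A seen colour survives all deletions but
    -- two; if it has a cherry it survives all but one, and the spare unit pays for its only cherry
    -- vertex. The losses stand on the right to avoid subtraction.
    seen-after-deletion : ∀ {m} (g : Fin (suc m) → Fin n) → Injective _≡_ _≡_ g → ∀ k →
      suc m * 𝟙 (Seen? g k) + count (Cherry? g k) ≤
      ∑[ v < suc m ] 𝟙 (Seen? (g ∘ punchIn v) k) + 2 * 𝟙 (Seen? g k)
    seen-after-deletion {m} g g-inj k with Seen? g k
    ... | no ¬seen = begin
      suc m * 0 + count (Cherry? g k)  ≡⟨ cong (_+ count (Cherry? g k)) (*-zeroʳ m) ⟩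
      count (Cherry? g k)              ≡⟨ count-none (Cherry? g k) (λ i (j , _ , _ , e , _) → ¬seen (i , j , e)) ⟩
      0                                ≤⟨ z≤n ⟩
      _                                ∎
      where open ≤-Reasoning
    ... | yes (x , y , e) with any? (Cherry? g k)
    ...   | yes (z , ch) = begin
      suc m * 1 + count (Cherry? g k)                ≡⟨ cong (_+ count (Cherry? g k)) (*-identityʳ (suc m)) ⟩
      suc m + count (Cherry? g k)                    ≤⟨ +-mono-≤ all-but-one cherries≤1 ⟩
      survivors + 1 + 1                              ≡⟨ +-assoc survivors 1 1 ⟩
      survivors + 2                                  ∎
      where
      open ≤-Reasoning
      survivors = ∑[ v < suc m ] 𝟙 (Seen? (g ∘ punchIn v) k)
      cherries≤1 : count (Cherry? g k) ≤ 1
      cherries≤1 = count-unique (Cherry? g k) λ i j p q →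
        g-inj (trans (cherry-at-centre g-inj p) (sym (cherry-at-centre g-inj q)))
      pointwise : ∀ v → 1 ≤ 𝟙 (Seen? (g ∘ punchIn v) k) + 𝟙 (v ≟ z)
      pointwise v with v ≟ z
      ... | yes _  = m≤n+m 1 _
      ... | no v≢z = ≤-trans (1≤𝟙 (Seen? (g ∘ punchIn v) k) (Seen-delete-cherry g v≢z ch)) (m≤m+n _ 0)
      all-but-one : suc m ≤ survivors + 1
      all-but-one = begin
        suc m                                                           ≤⟨ sum-≥1 pointwise ⟩
        ∑[ v < suc m ] (𝟙 (Seen? (g ∘ punchIn v) k) + 𝟙 (v ≟ z))        ≡⟨ ∑-distrib-+ {suc m} (λ v → 𝟙 (Seen? (g ∘ punchIn v) k)) (λ v → 𝟙 (v ≟ z)) ⟩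
        survivors + count (_≟ z)                                        ≤⟨ +-monoʳ-≤ survivors (count-unique (_≟ z) λ i j p q → trans p (sym q)) ⟩
        survivors + 1                                                   ∎
    -- One edge of the colour suffices here: only deleting `x` or `y` can destroy it.
    ...   | no ¬ch = begin
      suc m * 1 + count (Cherry? g k)  ≡⟨ cong (suc m * 1 +_) (count-none (Cherry? g k) λ i p → ¬ch (i , p)) ⟩
      suc m * 1 + 0                    ≡⟨ +-identityʳ _ ⟩
      suc m * 1                        ≡⟨ *-identityʳ (suc m) ⟩
      suc m                            ≤⟨ sum-≥1 pointwise ⟩
      ∑[ v < suc m ] (𝟙 (Seen? (g ∘ punchIn v) k) + (𝟙 (v ≟ x) + 𝟙 (v ≟ y)))
        ≡⟨ ∑-distrib-+ {suc m} (λ v → 𝟙 (Seen? (g ∘ punchIn v) k)) (λ v → 𝟙 (v ≟ x) + 𝟙 (v ≟ y)) ⟩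
      survivors + ∑[ v < suc m ] (𝟙 (v ≟ x) + 𝟙 (v ≟ y))
        ≡⟨ cong (survivors +_) (∑-distrib-+ {suc m} (λ v → 𝟙 (v ≟ x)) (λ v → 𝟙 (v ≟ y))) ⟩
      survivors + (count (_≟ x) + count (_≟ y))
        ≤⟨ +-monoʳ-≤ survivors (+-mono-≤ (count-unique (_≟ x) λ i j p q → trans p (sym q))
                                         (count-unique (_≟ y) λ i j p q → trans p (sym q))) ⟩
      survivors + 2                    ∎
      where
      open ≤-Reasoning
      survivors = ∑[ v < suc m ] 𝟙 (Seen? (g ∘ punchIn v) k)
      pointwise : ∀ v → 1 ≤ 𝟙 (Seen? (g ∘ punchIn v) k) + (𝟙 (v ≟ x) + 𝟙 (v ≟ y))
      pointwise v with v ≟ x | v ≟ y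
      ... | yes _  | _      = ≤-trans (m≤m+n 1 _) (m≤n+m _ (𝟙 (Seen? (g ∘ punchIn v) k)))
      ... | no _   | yes _  = m≤n+m 1 _
      ... | no v≢x | no v≢y = ≤-trans (1≤𝟙 (Seen? (g ∘ punchIn v) k) (Seen-delete g v≢x v≢y e)) (m≤m+n _ 0)

    -- Two distinct edges of equal colour both contain the centre of that colour, so they form a
    -- cherry there, which is impossible at a non-centre.
    non-centres-rainbow : ∀ {m h} {g : Fin m → Fin n} → Injective _≡_ _≡_ g →
                          h ≤ count (¬? ∘ IsCentre? g) → RainbowCopy c (K h)
    non-centres-rainbow {m} {h} {g} g-inj h≤ with choose (¬? ∘ IsCentre? g) h h≤
    ... | f , f-inj , non-centre = record
      { vertex    = g ∘ f
      ; injective = f-inj ∘ g-inj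
      ; edge      = λ i≢j eq → i≢j (f-inj (g-inj eq))
      ; rainbow   = λ {i} {j} {i′} {j′} i≢j i′≢j′ ¬same same-colour →
          distinct ¬same (at-centre (edge i≢j , same-colour)) (at-centre (edge i′≢j′ , refl))
                   (edge i≢j , same-colour) (edge i′≢j′ , refl)
      }
      where
      edge : ∀ {i j} → i ≢ j → g (f i) ≢ g (f j)
      edge i≢j = i≢j ∘ f-inj ∘ g-inj

      vertex-injective : ∀ {i j} → g (f i) ≡ g (f j) → i ≡ j
      vertex-injective = f-inj ∘ g-inj

      no-cherry : ∀ {k i i′ j j′} → i ≡ i′ → j ≢ j′ →
                  InClass c k (g (f i)) (g (f j)) → InClass c k (g (f i′)) (g (f j′)) → ⊥
      no-cherry refl j≢j′ e e′ = non-centre _ (_ , _ , _ , j≢j′ ∘ f-inj , e , e′)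

      -- The four cases say which end of each edge is the centre `z`; `InClass-sym` turns the edges
      -- so that the shared end comes first.
      distinct : ∀ {k z i j i′ j′} → ¬ SameEdge i j i′ j′ →
                 g (f i) ≡ z ⊎ g (f j) ≡ z → g (f i′) ≡ z ⊎ g (f j′) ≡ z →
                 InClass c k (g (f i)) (g (f j)) → InClass c k (g (f i′)) (g (f j′)) → ⊥
      distinct ¬same (inj₁ p) (inj₁ q) e e′ = no-cherry i≡i′ (λ eq → ¬same (inj₁ (i≡i′ , eq))) e e′
        where i≡i′ = vertex-injective (trans p (sym q))
      distinct ¬same (inj₁ p) (inj₂ q) e e′ = no-cherry i≡j′ (λ eq → ¬same (inj₂ (i≡j′ , eq))) e (InClass-sym e′)
        where i≡j′ = vertex-injective (trans p (sym q))
      distinct ¬same (inj₂ p) (inj₁ q) e e′ = no-cherry j≡i′ (λ eq → ¬same (inj₂ (eq , j≡i′))) (InClass-sym e) e′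
        where j≡i′ = vertex-injective (trans p (sym q))
      distinct ¬same (inj₂ p) (inj₂ q) e e′ = no-cherry j≡j′ (λ eq → ¬same (inj₁ (eq , j≡j′))) (InClass-sym e) (InClass-sym e′)
        where j≡j′ = vertex-injective (trans p (sym q))

    -- Every centre lies in at least one pair of a colour and a cherry vertex; exchanging the sums
    -- groups these pairs by colour.
    centres-or-cherries : ∀ {m} (g : Fin m → Fin n) →
      m ≤ count (¬? ∘ IsCentre? g) + ∑[ k < s ] count (Cherry? g k)
    centres-or-cherries {m} g = begin
      m                                                             ≤⟨ sum-≥1 pointwise ⟩
      ∑[ i < m ] (𝟙 (¬? (IsCentre? g i)) + ∑[ k < s ] 𝟙 (Cherry? g k i))
        ≡⟨ ∑-distrib-+ {m} (λ i → 𝟙 (¬? (IsCentre? g i))) _ ⟩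
      non-centres + ∑[ i < m ] ∑[ k < s ] 𝟙 (Cherry? g k i)
        ≡⟨ cong (non-centres +_) (∑-comm {m} {s} λ i k → 𝟙 (Cherry? g k i)) ⟩
      non-centres + ∑[ k < s ] count (Cherry? g k)                  ∎
      where
      open ≤-Reasoning
      non-centres = count (¬? ∘ IsCentre? g)
      pointwise : ∀ i → 1 ≤ 𝟙 (¬? (IsCentre? g i)) + ∑[ k < s ] 𝟙 (Cherry? g k i)
      pointwise i with IsCentre? g i
      ... | yes cen = count-some (λ k → Cherry? g k i) cen
      ... | no _    = m≤m+n 1 _

    averaging : ∀ {m} (g : Fin (suc m) → Fin n) → Injective _≡_ _≡_ g →
      suc m * count (Seen? g) + ∑[ k < s ] count (Cherry? g k) ≤
      ∑[ v < suc m ] count (Seen? (g ∘ punchIn v)) + 2 * count (Seen? g)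
    averaging {m} g g-inj = begin
      suc m * count (Seen? g) + cherries
        ≡⟨ cong (_+ cherries) (*-distribˡ-sum {s} (suc m) (λ k → 𝟙 (Seen? g k))) ⟩
      ∑[ k < s ] (suc m * 𝟙 (Seen? g k)) + cherries
        ≡⟨ ∑-distrib-+ {s} (λ k → suc m * 𝟙 (Seen? g k)) _ ⟨
      ∑[ k < s ] (suc m * 𝟙 (Seen? g k) + count (Cherry? g k))
        ≤⟨ sum-mono-≤ (seen-after-deletion g g-inj) ⟩
      ∑[ k < s ] (∑[ v < suc m ] 𝟙 (Seen? (g ∘ punchIn v) k) + 2 * 𝟙 (Seen? g k))
        ≡⟨ ∑-distrib-+ {s} (λ k → ∑[ v < suc m ] 𝟙 (Seen? (g ∘ punchIn v) k)) _ ⟩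
      ∑[ k < s ] ∑[ v < suc m ] 𝟙 (Seen? (g ∘ punchIn v) k) + ∑[ k < s ] (2 * 𝟙 (Seen? g k))
        ≡⟨ cong₂ _+_ (∑-comm {s} {suc m} λ k v → 𝟙 (Seen? (g ∘ punchIn v) k))
                     (sym (*-distribˡ-sum {s} 2 (λ k → 𝟙 (Seen? g k)))) ⟩
      ∑[ v < suc m ] count (Seen? (g ∘ punchIn v)) + 2 * count (Seen? g) ∎
      where
      open ≤-Reasoning
      cherries = ∑[ k < s ] count (Cherry? g k)

    -- Induction on the size `2 + a`, which lets 2|S| - 3 be written without subtraction. Two
    -- vertices span one edge, hence one colour.
    colours-seen-≤ : ¬ RainbowCopy c (K 4) → ∀ a (g : Fin (2 + a) → Fin n) →
                     Injective _≡_ _≡_ g → count (Seen? g) ≤ 1 + 2 * a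
    colours-seen-≤ _ zero g g-inj =
      count-unique (Seen? g) λ k l p q → trans (sym (only-edge p)) (only-edge q)
      where
      0≢1 : g 0F ≢ g 1F
      0≢1 eq = 0≢1+n (g-inj eq)
      only-edge : ∀ {k} → Seen g k → colour c (g 0F) (g 1F) 0≢1 ≡ k
      only-edge (0F , 0F , ne , _)  = contradiction refl ne
      only-edge (0F , 1F , _  , eq) = eq
      only-edge (1F , 0F , e)       = proj₂ (InClass-sym e)
      only-edge (1F , 1F , ne , _)  = contradiction refl ne
    colours-seen-≤ ¬K₄ (suc a) g g-inj = ≤-pred (≤-trans (*-cancelˡ-< (1 + a) f _ bound) (≤-reflexive (4+2a a)))
      where
      open ≤-Reasoning
      f        = count (Seen? g)
      cherries = ∑[ k < s ] count (Cherry? g k)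

      4+2a : ∀ a → 4 + 2 * a ≡ 2 + 2 * (1 + a)
      4+2a = solve-∀
      -- Separates two of the `3 + a` copies of `f`, to be cancelled against the `2 * f` in
      -- `averaging`.
      split : ∀ a f x → (3 + a) * f + x ≡ (1 + a) * f + x + 2 * f
      split = solve-∀
      -- The averaged bound falls short of the right-hand side by exactly one. This gives the strict
      -- inequality that survives division by `1 + a`.
      product : ∀ a → suc ((3 + a) * (1 + 2 * a)) ≡ (1 + a) * (4 + 2 * a) + a
      product = solve-∀

      non-centres≤3 : count (¬? ∘ IsCentre? g) ≤ 3
      non-centres≤3 = ≮⇒≥ (¬K₄ ∘ non-centres-rainbow g-inj)

      a≤cherries : a ≤ cherries
      a≤cherries = +-cancelˡ-≤ 3 a cherries
        (≤-trans (centres-or-cherries g) (+-monoˡ-≤ cherries non-centres≤3))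

      deletions : ∑[ v < 3 + a ] count (Seen? (g ∘ punchIn v)) ≤ (3 + a) * (1 + 2 * a)
      deletions = begin
        ∑[ v < 3 + a ] count (Seen? (g ∘ punchIn v))
          ≤⟨ sum-mono-≤ {3 + a} (λ v → colours-seen-≤ ¬K₄ a (g ∘ punchIn v) (punchIn-injective v _ _ ∘ g-inj)) ⟩
        ∑[ v < 3 + a ] (1 + 2 * a)  ≡⟨ sum-const (3 + a) (1 + 2 * a) ⟩
        (3 + a) * (1 + 2 * a)       ∎

      bound : (1 + a) * f < (1 + a) * (4 + 2 * a)
      bound = +-cancelʳ-< a _ _ (begin
        suc ((1 + a) * f + a)           ≤⟨ s≤s (+-monoʳ-≤ ((1 + a) * f) a≤cherries) ⟩
        suc ((1 + a) * f + cherries)    ≤⟨ s≤s (+-cancelʳ-≤ (2 * f) _ _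
                                             (≤-trans (≤-reflexive (sym (split a f cherries))) (averaging g g-inj))) ⟩
        suc (∑[ v < 3 + a ] count (Seen? (g ∘ punchIn v)))  ≤⟨ s≤s deletions ⟩
        suc ((3 + a) * (1 + 2 * a))     ≡⟨ product a ⟩
        (1 + a) * (4 + 2 * a) + a       ∎)

-- The whole vertex set is given by `id`, and every colour is seen in it by `onto`.
upper-bound : ∀ a {s} → StarColourableWithout (2 + a) (K 4) s → s ≤ 1 + 2 * a
upper-bound a (c , star , onto , ¬K₄) = ≤-trans
  (sum-≥1 (λ k → 1≤𝟙 (Seen? c id k) (onto k)))
  (colours-seen-≤ c (λ k → proj₁ (star-centre c star k (onto k)))
                    (λ {k} → proj₂ (star-centre c star k (onto k))) ¬K₄ a id id)

-- The lower bound

-- The construction can start at two vertices, where 2n - 3 is 1 and four vertices do not fit.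
K₂-colourable : StarColourableWithout 2 (K 4) 1
K₂-colourable =
    record { colour = λ _ _ _ → zero ; colour-sym = λ _ _ _ → refl }
  , (λ { zero _ → 1 , ≤-refl , id , id , λ u v → mk⇔ (λ { (ne , _) → u , v , adj u v ne , refl , refl })
                                                    (λ { (_ , _ , e , refl , refl) → adj⇒≢ e , refl }) })
  , (λ { zero → 0F , 1F , (λ ()) , refl })
  , λ R → contradiction (injective⇒≤ (RainbowCopy.injective R)) λ { (s≤s (s≤s ())) }
  where
  adj : ∀ u v → u ≢ v → Adj (Star 1) u v
  adj 0F 0F ne = contradiction refl ne
  adj 0F 1F _  = inj₁ (refl , λ ())
  adj 1F 0F _  = inj₂ ((λ ()) , refl)
  adj 1F 1F ne = contradiction refl ne
  adj⇒≢ : ∀ {u v} → Adj (Star 1) u v → u ≢ v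
  adj⇒≢ e eq = Graph.irrefl (Star 1) eq e

-- Adding one vertex and two colours

module Extend {n s} (c : Colouring (K (2 + n)) s) where

  -- The new vertex is `zero` and old vertices are shifted by `suc`. The edge to the old `zero` is
  -- the one that gets a colour of its own.
  spoke : Fin (2 + n) → Fin 2
  spoke zero    = 0F
  spoke (suc _) = 1F

  extend-colour : (u v : Fin (3 + n)) → .(u ≢ v) → Fin (2 + s)
  extend-colour zero    zero    u≢v = ⊥-elim-irr (u≢v refl)
  extend-colour zero    (suc v) _   = spoke v ↑ˡ s
  extend-colour (suc u) zero    _   = spoke u ↑ˡ s
  extend-colour (suc u) (suc v) u≢v = 2 ↑ʳ colour c u v (u≢v ∘ cong suc)

  extend : Colouring (K (3 + n)) (2 + s)
  extend = record { colour = extend-colour ; colour-sym = extend-sym }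
    where
    extend-sym : ∀ u v (e : u ≢ v) → extend-colour u v e ≡ extend-colour v u (≢-sym e)
    extend-sym zero    zero    e = contradiction refl e
    extend-sym zero    (suc v) e = refl
    extend-sym (suc u) zero    e = refl
    extend-sym (suc u) (suc v) e = cong (2 ↑ʳ_) (Colouring.colour-sym c u v (e ∘ cong suc))

  extend-star : IsStarColouring c → IsStarColouring extend
  extend-star star zero _ = 1 , ≤-refl , f , f-inj , λ u v → mk⇔ (to u v) from
    where
    f : Fin 2 → Fin (3 + n)
    f 0F = 0F
    f 1F = 1F
    f-inj : Injective _≡_ _≡_ f
    f-inj {0F} {0F} _ = refl
    f-inj {0F} {1F} ()
    f-inj {1F} {0F} ()
    f-inj {1F} {1F} _ = refl
    to : ∀ u v → InClass extend zero u v → ∃[ i ] ∃[ j ] (Adj (Star 1) i j × f i ≡ u × f j ≡ v)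
    to zero          zero          (ne , _) = contradiction refl ne
    to zero          (suc zero)    _        = 0F , 1F , inj₁ (refl , λ ()) , refl , refl
    to (suc zero)    zero          _        = 1F , 0F , inj₂ ((λ ()) , refl) , refl , refl
    to zero          (suc (suc v)) (_ , ())
    to (suc (suc u)) zero          (_ , ())
    to (suc u)       (suc v)       (_ , ())
    from : ∀ {u v} → (∃[ i ] ∃[ j ] (Adj (Star 1) i j × f i ≡ u × f j ≡ v)) → InClass extend zero u v
    from (0F , 1F , _ , refl , refl) = (λ ()) , refl
    from (1F , 0F , _ , refl , refl) = (λ ()) , refl
    from (0F , 0F , e , refl , refl) = contradiction e (Graph.irrefl (Star 1) refl)
    from (1F , 1F , e , refl , refl) = contradiction e (Graph.irrefl (Star 1) refl)
  extend-star star (suc zero) _ = suc n , s≤s z≤n , f , f-inj , λ u v → mk⇔ (to u v) from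
    where
    f : Fin (2 + n) → Fin (3 + n)
    f zero    = zero
    -- The leaves omit vertex `1F`, whose edge to the new vertex has colour `0F`.
    f (suc i) = suc (suc i)
    f-inj : Injective _≡_ _≡_ f
    f-inj {zero}  {zero}  _  = refl
    f-inj {suc i} {suc j} eq = suc-injective eq
    to : ∀ u v → InClass extend 1F u v → ∃[ i ] ∃[ j ] (Adj (Star (suc n)) i j × f i ≡ u × f j ≡ v)
    to zero          zero          (ne , _) = contradiction refl ne
    to zero          (suc zero)    (_ , ())
    to (suc zero)    zero          (_ , ())
    to zero          (suc (suc v)) _ = zero , suc v , inj₁ (refl , λ ()) , refl , refl
    to (suc (suc u)) zero          _ = suc u , zero , inj₂ ((λ ()) , refl) , refl , refl
    to (suc u)       (suc v)       (_ , ())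
    from : ∀ {u v} → (∃[ i ] ∃[ j ] (Adj (Star (suc n)) i j × f i ≡ u × f j ≡ v)) → InClass extend 1F u v
    from (zero  , suc j , _ , refl , refl) = (λ ()) , refl
    from (suc i , zero  , _ , refl , refl) = (λ ()) , refl
    from (zero  , zero  , e , refl , refl) = contradiction e (Graph.irrefl (Star (suc n)) refl)
    from (suc i , suc j , inj₁ (() , _) , _)
    from (suc i , suc j , inj₂ (_ , ()) , _)
  extend-star star (suc (suc k)) (u , v , used)
    with star k (restrict u v used)
    where
    -- Edges at the new vertex have new colours. Splitting their old end makes `spoke` reduce, which
    -- exposes the clash.
    restrict : ∀ u v → InClass extend (2 ↑ʳ k) u v → ∃[ u ] ∃[ v ] InClass c k u v
    restrict zero          zero          (ne , _) = contradiction refl ne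
    restrict zero          (suc zero)    (_ , ())
    restrict zero          (suc (suc v)) (_ , ())
    restrict (suc zero)    zero          (_ , ())
    restrict (suc (suc u)) zero          (_ , ())
    restrict (suc u)       (suc v)       (ne , eq) = u , v , ne ∘ cong suc , ↑ʳ-injective 2 _ _ eq
  ... | m , 1≤m , f , f-inj , copy = m , 1≤m , suc ∘ f , f-inj ∘ suc-injective , λ u v → mk⇔ (to u v) from
    where
    to : ∀ u v → InClass extend (2 ↑ʳ k) u v → ∃[ i ] ∃[ j ] (Adj (Star m) i j × suc (f i) ≡ u × suc (f j) ≡ v)
    to zero          zero          (ne , _) = contradiction refl ne
    to zero          (suc zero)    (_ , ())
    to zero          (suc (suc v)) (_ , ())
    to (suc zero)    zero          (_ , ())
    to (suc (suc u)) zero          (_ , ())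
    to (suc u)       (suc v)       (ne , eq) =
      let i , j , e , p , q = Equivalence.to (copy u v) (ne ∘ cong suc , ↑ʳ-injective 2 _ _ eq)
      in  i , j , e , cong suc p , cong suc q
    from : ∀ {u v} → (∃[ i ] ∃[ j ] (Adj (Star m) i j × suc (f i) ≡ u × suc (f j) ≡ v)) →
           InClass extend (2 ↑ʳ k) u v
    from (i , j , e , refl , refl) =
      let ne , eq = Equivalence.from (copy (f i) (f j)) (i , j , e , refl , refl)
      in  ne ∘ suc-injective , cong (2 ↑ʳ_) eq

  extend-onto : UsesAllColours c → UsesAllColours extend
  extend-onto onto zero          = 0F , 1F , (λ ()) , refl
  extend-onto onto (suc zero)    = 0F , suc 1F , (λ ()) , refl
  extend-onto onto (suc (suc k)) =
    let u , v , ne , eq = onto k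
    in  suc u , suc v , ne ∘ suc-injective , cong (2 ↑ʳ_) eq

  -- Carries the pigeonhole collision back to colours: once `v` and `v′` are successors, `punchOut`
  -- yields their predecessors.
  spoke-colour : ∀ {u v v′} .(e : u ≢ v) .(e′ : u ≢ v′) (p : u ≡ zero) (q : v ≢ zero) (q′ : v′ ≢ zero) →
                 spoke (punchOut (≢-sym q)) ≡ spoke (punchOut (≢-sym q′)) →
                 extend-colour u v e ≡ extend-colour u v′ e′
  spoke-colour {v = zero}               _ _ refl q _  _  = contradiction refl q
  spoke-colour {v = suc _} {v′ = zero}  _ _ refl _ q′ _  = contradiction refl q′
  spoke-colour {v = suc _} {v′ = suc _} _ _ refl _ _  eq = cong (_↑ˡ s) eq

  -- A copy through the new vertex has three edges there but only two colours for them; any other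
  -- copy already lies in `c`.
  extend-rainbow-free : ¬ RainbowCopy c (K 4) → ¬ RainbowCopy extend (K 4)
  extend-rainbow-free ¬K₄ R with any? (λ i → RainbowCopy.vertex R i ≟ zero)
  ... | yes (i , vᵢ≡0) = rainbow (i≢ j) (i≢ j′) distinct
                           (spoke-colour (edge (i≢ j)) (edge (i≢ j′)) vᵢ≡0 (≢0 j) (≢0 j′) same-spoke)
    where
    open RainbowCopy R
    i≢ : ∀ j → i ≢ punchIn i j
    i≢ j = ≢-sym (punchInᵢ≢i i j)
    ≢0 : ∀ j → vertex (punchIn i j) ≢ zero
    ≢0 j eq = i≢ j (injective (trans vᵢ≡0 (sym eq)))
    -- `punchIn i` enumerates the three other vertices of the copy.
    two-alike = pigeonhole {2} {3} (s<s (s<s z<s)) λ j → spoke (punchOut (≢-sym (≢0 j)))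
    j  = proj₁ two-alike
    j′ = proj₁ (proj₂ two-alike)
    same-spoke = proj₂ (proj₂ (proj₂ two-alike))
    distinct : ¬ SameEdge i (punchIn i j) i (punchIn i j′)
    distinct (inj₁ (_ , eq)) = <⇒≢ (proj₁ (proj₂ (proj₂ two-alike))) (punchIn-injective i _ _ eq)
    distinct (inj₂ (eq , _)) = i≢ j′ eq
  ... | no none = ¬K₄ record
    { vertex    = v
    ; injective = λ eq → injective (trans (sym (suc-v _)) (trans (cong suc eq) (suc-v _)))
    ; edge      = λ i≢j eq → edge i≢j (trans (sym (suc-v _)) (trans (cong suc eq) (suc-v _)))
    ; rainbow   = λ {i} {j} {i′} {j′} e e′ ¬same eq → rainbow e e′ ¬same
        (trans (sym (lifted (suc-v i) (suc-v j) _ (edge e)))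
        (trans (cong (2 ↑ʳ_) eq) (lifted (suc-v i′) (suc-v j′) _ (edge e′))))
    }
    where
    open RainbowCopy R
    ≢0 : ∀ i → zero ≢ vertex i
    ≢0 i eq = none (i , sym eq)
    v : Fin 4 → Fin (2 + n)
    v i = punchOut (≢0 i)
    suc-v : ∀ i → suc (v i) ≡ vertex i
    suc-v i = punchIn-punchOut (≢0 i)
    -- With `u′` and `w′` variable, both equations match `refl` and `extend-colour` reduces.
    lifted : ∀ {u w u′ w′} → suc u ≡ u′ → suc w ≡ w′ → .(e : u ≢ w) .(e′ : u′ ≢ w′) →
             2 ↑ʳ colour c u w e ≡ extend-colour u′ w′ e′
    lifted refl refl _ _ = refl

-- With `a * 2` instead of `2 * a`, the two colours added per step agree with the index by
-- computation.
lower-bound : ∀ a → StarColourableWithout (2 + a) (K 4) (1 + a * 2)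
lower-bound zero    = K₂-colourable
lower-bound (suc a) =
  let c , star , onto , ¬K₄ = lower-bound a
      open Extend c
  in  extend , extend-star star , extend-onto onto , extend-rainbow-free ¬K₄

theorem1p5 : ∀ (n : ℕ) → 4 ≤ n → ar⋆[ n , K 4 ]≐ (2 * n ∸ 3)
theorem1p5 (suc zero) (s≤s ())
theorem1p5 (suc (suc a)) _ =
    subst (StarColourableWithout (2 + a) (K 4)) (trans (cong suc (*-comm a 2)) 1+2a) (lower-bound a)
  , λ s colourable → ≤-trans (upper-bound a colourable) (≤-reflexive 1+2a)
  where
  -- With `3 +` in front, the truncated subtraction of 3 computes.
  4+2a : ∀ a → 3 + (1 + 2 * a) ≡ 2 * (2 + a)
  4+2a = solve-∀
  1+2a : 1 + 2 * a ≡ 2 * (2 + a) ∸ 3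
  1+2a = cong (_∸ 3) (4+2a a)
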